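{- Let $Q$ be a generalized quadrangle of order $q$ and let $G$ be the incidence graph of $Q$. Then $Q$ contains two disjoint ovoids or two disjoint spreads if and only if $$\chi_\rho (G)=(q^2+1)(q-1)+3.$$
   Context: All graphs are finite, simple and undirected. A packing $k$-coloring of a graph $G$ is a function $\Gamma: V(G)\to\{1,2,\dots,k\}$ such that for every $i$, any two distinct vertices of color $i$ are at distance at least $i+1$. The packing chromatic number $\chi_\rho(G)$ is the smallest integer $k$ for which $G$ has a packing $k$-coloring. Let $\mathcal{P}$ (points) and $\mathcal{L}$ (lines) be disjoint non-empty sets with an incidence relation $I$ between them. The incidence graph is the bipartite graph on $\mathcal{P}\cup\mathcal{L}$ in which each point is joined to its incident lines. A generalized quadrangle of order $q$ (symmetric generalized $4$-gon), $q\ge 1$ an integer, is a triple $(\mathcal{P},\mathcal{L},I)$ such that every line is incident to exactly $q+1$ points and every point to exactly $q+1$ lines; any two distinct lines intersect in at most one point and there is at most one line through any two distinct points; and the incidence graph has diameter $4$ and girth $8$. Distances between elements of $Q$ are taken in the incidence graph. Two points (or two lines) are opposite if they are at distance $4$. An ovoid (resp. spread) of $Q$ is a set of $q^2+1$ mutually opposite points (resp. lines) such that every element of $Q$ (point or line) is at distance at most $2$ from at least one point (resp. line) of the set. -}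

module Defs where

open import Data.Fin.Base using (Fin; zero; suc; inject₁; fromℕ)
open import Data.Fin.Properties using (+↔⊎)
open import Data.List.Base using (List; length)
open import Data.List.Membership.Propositional using (_∈_)
open import Data.List.Relation.Unary.Unique.Propositional using (Unique)
open import Data.Nat.Base using (ℕ; zero; suc; _+_; _^_; _≤_)
open import Data.Product.Base using (Σ; ∃; ∃₂; _×_; _,_)
open import Data.Sum.Base using (_⊎_; inj₁; inj₂)
open import Data.Sum.Function.Propositional using (_⊎-↔_)
open import Function.Bundles using (_↔_; _⇔_)
open import Function.Construct.Composition using (_↔-∘_)
open import Function.Construct.Symmetry using (↔-sym)
open import Function.Definitions using (Injective)
open import Level using (0ℓ)
open import Relation.Binary.Core using (Rel; REL)
open import Relation.Binary.Definitions using (Decidable; Symmetric; Irreflexive)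
open import Relation.Binary.PropositionalEquality.Core using (_≡_; _≢_)
open import Relation.Nullary.Decidable.Core using (yes; no)
open import Relation.Unary using (Pred) renaming (_⊥_ to Disjoint)

Finite : Set → Set
Finite A = ∃ λ n → A ↔ Fin n

-- Counts elements of A, not proofs of P, so P need not be proof-irrelevant.
HasCardinality : {A : Set} → Pred A 0ℓ → ℕ → Set
HasCardinality {A} P n =
  Σ (List A) λ xs → Unique xs × (∀ x → x ∈ xs ⇔ P x) × length xs ≡ n

-- Decidability of adjacency is automatic classically; here it is part of
-- what it means for the edge set to be finite.
record Graph : Set₁ where
  field
    V      : Set
    finite : Finite V
    Adj    : Rel V 0ℓ
    adj?   : Decidable Adj
    sym    : Symmetric Adj
    irrefl : Irreflexive _≡_ Adj

module _ (G : Graph) where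
  open Graph G

  data Walk : V → V → ℕ → Set where
    []  : ∀ {u} → Walk u u 0
    _∷_ : ∀ {u v w n} → Adj u v → Walk v w n → Walk u w (suc n)

  -- A relation rather than a function: vertices in different components
  -- have no (i.e. infinite) distance.
  Distance : V → V → ℕ → Set
  Distance u v d = Walk u v d × (∀ n → Walk u v n → d ≤ n)

  DistanceAtMost : V → V → ℕ → Set
  DistanceAtMost u v k = ∃ λ d → Distance u v d × d ≤ k

  DistanceAtLeast : V → V → ℕ → Set
  DistanceAtLeast u v k = ∀ d → Distance u v d → k ≤ d

  HasDiameter : ℕ → Set
  HasDiameter d =
    (∀ u v → DistanceAtMost u v d) × ∃₂ λ u v → Distance u v d

  -- A cycle with suc m vertices, hence of length suc m.
  record IsCycle (m : ℕ) (c : Fin (suc m) → V) : Set where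
    field
      3≤length : 3 ≤ suc m
      distinct : Injective _≡_ _≡_ c
      step     : ∀ (i : Fin m) → Adj (c (inject₁ i)) (c (suc i))
      close    : Adj (c (fromℕ m)) (c zero)

  HasCycleOfLength : ℕ → Set
  HasCycleOfLength n = ∃ λ m → n ≡ suc m × ∃ λ c → IsCycle m c

  HasGirth : ℕ → Set
  HasGirth g = HasCycleOfLength g × (∀ n → HasCycleOfLength n → g ≤ n)

  record IsPackingColoring (k : ℕ) (Γ : V → ℕ) : Set where
    field
      range   : ∀ v → 1 ≤ Γ v × Γ v ≤ k
      packing : ∀ i u v → u ≢ v → Γ u ≡ i → Γ v ≡ i →
                DistanceAtLeast u v (i + 1)

  HasPackingColoring : ℕ → Set
  HasPackingColoring k = ∃ λ Γ → IsPackingColoring k Γ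

  -- χρ(G) = k, stated as "k is the least number of colors".
  PackingChromaticNumberIs : ℕ → Set
  PackingChromaticNumberIs k =
    HasPackingColoring k × (∀ j → HasPackingColoring j → k ≤ j)

record IncidenceStructure : Set₁ where
  infix 4 _I_
  field
    Point   : Set
    Line    : Set
    finiteP : Finite Point
    finiteL : Finite Line
    _I_     : REL Point Line 0ℓ
    _I?_    : Decidable _I_

module _ (S : IncidenceStructure) where
  open IncidenceStructure S

  Element : Set
  Element = Point ⊎ Line

  data Incident : Rel Element 0ℓ where
    point-line : ∀ {p l} → p I l → Incident (inj₁ p) (inj₂ l)
    line-point : ∀ {p l} → p I l → Incident (inj₂ l) (inj₁ p)

  private
    incident? : Decidable Incident
    incident? (inj₁ p) (inj₁ p′) = no λ ()
    incident? (inj₁ p) (inj₂ l) with p I? l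
    ... | yes pIl = yes (point-line pIl)
    ... | no ¬pIl = no λ { (point-line pIl) → ¬pIl pIl }
    incident? (inj₂ l) (inj₁ p) with p I? l
    ... | yes pIl = yes (line-point pIl)
    ... | no ¬pIl = no λ { (line-point pIl) → ¬pIl pIl }
    incident? (inj₂ l) (inj₂ l′) = no λ ()

    incident-sym : Symmetric Incident
    incident-sym (point-line pIl) = line-point pIl
    incident-sym (line-point pIl) = point-line pIl

    incident-irrefl : Irreflexive _≡_ Incident
    incident-irrefl {inj₁ p} _≡_.refl ()
    incident-irrefl {inj₂ l} _≡_.refl ()

    finiteElement : Finite Element
    finiteElement with finiteP | finiteL
    ... | m , f | n , g = m + n , ↔-sym +↔⊎ ↔-∘ (f ⊎-↔ g)

  incidenceGraph : Graph
  incidenceGraph = record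
    { V      = Element
    ; finite = finiteElement
    ; Adj    = Incident
    ; adj?   = incident?
    ; sym    = incident-sym
    ; irrefl = incident-irrefl
    }

  record IsGeneralizedQuadrangle (q : ℕ) : Set where
    field
      1≤q              : 1 ≤ q
      somePoint        : Point
      someLine         : Line
      pointsOnLine     : ∀ l → HasCardinality (λ p → p I l) (q + 1)
      linesOnPoint     : ∀ p → HasCardinality (λ l → p I l) (q + 1)
      atMostOneMeet    : ∀ l l′ → l ≢ l′ → ∀ p p′ →
                         p I l → p I l′ → p′ I l → p′ I l′ → p ≡ p′
      atMostOneJoin    : ∀ p p′ → p ≢ p′ → ∀ l l′ →
                         p I l → p′ I l → p I l′ → p′ I l′ → l ≡ l′
      diameter         : HasDiameter incidenceGraph 4
      girth            : HasGirth incidenceGraph 8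

  Opposite : Rel Element 0ℓ
  Opposite x y = Distance incidenceGraph x y 4

  record IsOvoid (q : ℕ) (O : Pred Point 0ℓ) : Set where
    field
      size     : HasCardinality O (q ^ 2 + 1)
      opposite : ∀ p p′ → O p → O p′ → p ≢ p′ → Opposite (inj₁ p) (inj₁ p′)
      covering : ∀ (x : Element) →
                 ∃ λ p → O p × DistanceAtMost incidenceGraph x (inj₁ p) 2

  record IsSpread (q : ℕ) (S′ : Pred Line 0ℓ) : Set where
    field
      size     : HasCardinality S′ (q ^ 2 + 1)
      opposite : ∀ l l′ → S′ l → S′ l′ → l ≢ l′ → Opposite (inj₂ l) (inj₂ l′)
      covering : ∀ (x : Element) →
                 ∃ λ l → S′ l × DistanceAtMost incidenceGraph x (inj₂ l) 2

  TwoDisjointOvoids : ℕ → Set₁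
  TwoDisjointOvoids q =
    ∃₂ λ O₁ O₂ → IsOvoid q O₁ × IsOvoid q O₂ × Disjoint O₁ O₂

  TwoDisjointSpreads : ℕ → Set₁
  TwoDisjointSpreads q =
    ∃₂ λ S₁ S₂ → IsSpread q S₁ × IsSpread q S₂ × Disjoint S₁ S₂

record GeneralizedQuadrangle (q : ℕ) : Set₁ where
  field
    structure               : IncidenceStructure
    isGeneralizedQuadrangle : IsGeneralizedQuadrangle structure q

{-# OPTIONS --safe #-}
module Submission where

-- Let k = q + 1, m = q² + 1 and n = k m; counting paths of length 3 shows that
-- each side of the bipartite graph G has n vertices. Write c₁, c₂, c₃ for the
-- sizes of the first three colour classes of a packing colouring; all other
-- classes are singletons as G has diameter 4. Counting edges, c₁ ≤ n since
-- class 1 is independent, and k (c₁ + c₂) ≤ k n + c₁, since an edge with both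
-- ends in classes 1 and 2 joins the two classes and a vertex of class 1 has at
-- most one neighbour in class 2; hence c₁ + c₂ ≤ n + m. The neighbourhood of
-- class 3 is independent and has k c₃ vertices, so c₃ ≤ m. As there are 2 n
-- vertices, at least m (q - 1) + 3 colours are needed, and in case of equality
-- c₁ = n and c₂ = c₃ = m, which makes class 1 one side of G and classes 2 and 3
-- two ovoids (or spreads) in the other side.

open import Defs
open import Data.Bool.Base using (Bool; true; false; not)
open import Data.Bool.Properties using (not-involutive; not-¬; ¬-not) renaming (_≟_ to _≟ᵇ_)
open import Data.Empty using (⊥)
open import Data.Fin.Base using (toℕ)
open import Data.Fin.Patterns using (0F; 1F; 2F; 3F; 4F)
open import Data.Fin.Properties using (toℕ<n; toℕ-injective; inj⇒≟)
open import Data.List.Base using (List; []; _∷_; map; length; filter; tabulate; upTo; lookup)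
import Data.List.Membership.DecPropositional as DecMembership
open import Data.List.Membership.Propositional using (_∈_; find; lose)
open import Data.List.Membership.Propositional.Properties
  using (∈-filter⁺; ∈-filter⁻; ∈-map⁺; ∈-map⁻; ∈-tabulate⁺; ∈-upTo⁺)
open import Data.List.Membership.Propositional.Properties.WithK using (unique∧set⇒bag)
open import Data.List.Properties using (length-map; length-upTo)
open import Data.List.Relation.Binary.BagAndSetEquality using (∼bag⇒↭)
open import Data.List.Relation.Binary.Permutation.Propositional.Properties using (↭-length)
open import Data.List.Relation.Unary.All using ([]; _∷_)
open import Data.List.Relation.Unary.AllPairs using ([]; _∷_)
open import Data.List.Relation.Unary.Any using (any?; here; there; index)
open import Data.List.Relation.Unary.Any.Properties using (lookup-index)
open import Data.List.Relation.Unary.Unique.Propositional using (Unique)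
open import Data.List.Relation.Unary.Unique.Propositional.Properties using (filter⁺; map⁺; tabulate⁺)
open import Data.Nat.Base
open import Data.Nat.ListAction using (sum)
open import Data.Nat.Properties renaming (_≟_ to _≟ℕ_)
open import Data.Nat.Tactic.RingSolver using (solve-∀)
open import Data.Product.Base using (∃; _×_; _,_; proj₁; proj₂)
open import Data.Sum.Base using (_⊎_; inj₁; inj₂; [_,_])
open import Data.Sum.Properties using (inj₁-injective; inj₂-injective)
open import Data.Vec.Base as Vec using (Vec; []; _∷_)
open import Data.Vec.Relation.Unary.All using ([]; _∷_)
open import Data.Vec.Relation.Unary.AllPairs using ([]; _∷_)
open import Data.Vec.Relation.Unary.Unique.Propositional.Properties using (lookup-injective)
open import Function.Base using (_∘_; id)
open import Function.Bundles using (_⇔_; mk⇔; Equivalence; Inverse)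
open import Function.Properties.Inverse using (Inverse⇒Injection)
open import Level using (0ℓ)
open import Relation.Binary.Definitions using (DecidableEquality)
open import Relation.Binary.PropositionalEquality hiding (J; [_])
open import Relation.Nullary.Decidable using (Dec; yes; no; map′; _×-dec_; ¬?)
open import Relation.Nullary.Negation using (¬_; contradiction)
open import Relation.Unary using (Pred; Decidable)

private variable A B : Set

-- Indicators and finite sums.

⟦_⟧ : {P : Set} → Dec P → ℕ
⟦ yes _ ⟧ = 1
⟦ no _ ⟧ = 0

module _ {P : Set} where

  ⟦⟧-yes : (P? : Dec P) → P → ⟦ P? ⟧ ≡ 1
  ⟦⟧-yes (yes _) p = refl
  ⟦⟧-yes (no ¬p) p = contradiction p ¬p

  ⟦⟧-no : (P? : Dec P) → ¬ P → ⟦ P? ⟧ ≡ 0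
  ⟦⟧-no (yes p) ¬p = contradiction p ¬p
  ⟦⟧-no (no _) ¬p = refl

  ⟦⟧-≤1 : (P? : Dec P) → ⟦ P? ⟧ ≤ 1
  ⟦⟧-≤1 (yes _) = ≤-refl
  ⟦⟧-≤1 (no _) = z≤n

  ⟦⟧-true : (P? : Dec P) → 0 < ⟦ P? ⟧ → P
  ⟦⟧-true (yes p) _ = p

⟦⟧-⇔ : {P Q : Set} (P? : Dec P) (Q? : Dec Q) → (P → Q) → (Q → P) → ⟦ P? ⟧ ≡ ⟦ Q? ⟧
⟦⟧-⇔ (yes p) Q? f g = sym (⟦⟧-yes Q? (f p))
⟦⟧-⇔ (no ¬p) Q? f g = sym (⟦⟧-no Q? (¬p ∘ g))

⟦⟧-× : {P Q : Set} (P? : Dec P) (Q? : Dec Q) → ⟦ P? ⟧ * ⟦ Q? ⟧ ≡ ⟦ P? ×-dec Q? ⟧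
⟦⟧-× (yes _) (yes _) = refl
⟦⟧-× (yes _) (no _) = refl
⟦⟧-× (no _) _ = refl

m+m≤n+n⇒m≤n : ∀ {m n} → m + m ≤ n + n → m ≤ n
m+m≤n+n⇒m≤n h = ≮⇒≥ λ n<m → <⇒≱ (+-mono-< n<m n<m) h

∑ : List A → (A → ℕ) → ℕ
∑ xs f = sum (map f xs)

infix 5 ∑
syntax ∑ xs (λ x → e) = ∑[ x ∈ xs ] e

∑-cong : (xs : List A) {f g : A → ℕ} → (∀ x → f x ≡ g x) → ∑ xs f ≡ ∑ xs g
∑-cong [] f≡g = refl
∑-cong (x ∷ xs) f≡g = cong₂ _+_ (f≡g x) (∑-cong xs f≡g)

∑-mono : (xs : List A) {f g : A → ℕ} → (∀ x → f x ≤ g x) → ∑ xs f ≤ ∑ xs g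
∑-mono [] f≤g = z≤n
∑-mono (x ∷ xs) f≤g = +-mono-≤ (f≤g x) (∑-mono xs f≤g)

∑-distrib-+ : (xs : List A) (f g : A → ℕ) → ∑ xs (λ x → f x + g x) ≡ ∑ xs f + ∑ xs g
∑-distrib-+ [] f g = refl
∑-distrib-+ (x ∷ xs) f g = begin
  f x + g x + ∑ xs (λ y → f y + g y)  ≡⟨ cong (f x + g x +_) (∑-distrib-+ xs f g) ⟩
  f x + g x + (∑ xs f + ∑ xs g)       ≡⟨ +-assoc (f x) (g x) _ ⟩
  f x + (g x + (∑ xs f + ∑ xs g))     ≡⟨ cong (f x +_) (+-comm (g x) _) ⟩
  f x + (∑ xs f + ∑ xs g + g x)       ≡⟨ cong (f x +_) (+-assoc (∑ xs f) _ _) ⟩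
  f x + (∑ xs f + (∑ xs g + g x))     ≡⟨ cong (λ t → f x + (∑ xs f + t)) (+-comm (∑ xs g) _) ⟩
  f x + (∑ xs f + (g x + ∑ xs g))     ≡⟨ sym (+-assoc (f x) _ _) ⟩
  (f x + ∑ xs f) + (g x + ∑ xs g)     ∎
  where open ≡-Reasoning

∑-*ˡ : (xs : List A) (c : ℕ) (f : A → ℕ) → ∑ xs (λ x → c * f x) ≡ c * ∑ xs f
∑-*ˡ [] c f = sym (*-zeroʳ c)
∑-*ˡ (x ∷ xs) c f = trans (cong (c * f x +_) (∑-*ˡ xs c f)) (sym (*-distribˡ-+ c (f x) _))

∑-*ʳ : (xs : List A) (f : A → ℕ) (c : ℕ) → ∑ xs (λ x → f x * c) ≡ ∑ xs f * c
∑-*ʳ xs f c = trans (∑-cong xs (λ x → *-comm (f x) c)) (trans (∑-*ˡ xs c f) (*-comm c _))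

∑-zero : (xs : List A) → ∑[ x ∈ xs ] 0 ≡ 0
∑-zero [] = refl
∑-zero (x ∷ xs) = ∑-zero xs

∑-one : (xs : List A) → ∑[ x ∈ xs ] 1 ≡ length xs
∑-one [] = refl
∑-one (x ∷ xs) = cong suc (∑-one xs)

∑-comm : (xs : List A) (ys : List B) (f : A → B → ℕ) →
  ∑[ x ∈ xs ] (∑[ y ∈ ys ] f x y) ≡ ∑[ y ∈ ys ] (∑[ x ∈ xs ] f x y)
∑-comm [] ys f = sym (∑-zero ys)
∑-comm (x ∷ xs) ys f =
  trans (cong (∑ ys (f x) +_) (∑-comm xs ys f)) (sym (∑-distrib-+ ys (f x) _))

-- No term can fall short, because the other terms cannot make up for it. This turns every equality
-- case below into termwise information.
∑-tight : (xs : List A) {f g : A → ℕ} → (∀ x → f x ≤ g x) → ∑ xs g ≤ ∑ xs f →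
  ∀ {x} → x ∈ xs → f x ≡ g x
∑-tight (x ∷ xs) {f} {g} f≤g ∑g≤∑f (here refl) =
  ≤-antisym (f≤g x) (+-cancelʳ-≤ (∑ xs g) (g x) (f x)
    (≤-trans ∑g≤∑f (+-monoʳ-≤ (f x) (∑-mono xs f≤g))))
∑-tight (x ∷ xs) {f} {g} f≤g ∑g≤∑f (there y∈xs) =
  ∑-tight xs f≤g (+-cancelˡ-≤ (g x) _ _ (≤-trans ∑g≤∑f (+-monoˡ-≤ _ (f≤g x)))) y∈xs

∑-⟦⟧ : {P : Pred A 0ℓ} (P? : Decidable P) (xs : List A) →
  ∑[ x ∈ xs ] ⟦ P? x ⟧ ≡ length (filter P? xs)
∑-⟦⟧ P? [] = refl
∑-⟦⟧ P? (x ∷ xs) with P? x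
... | yes _ = cong suc (∑-⟦⟧ P? xs)
... | no _ = ∑-⟦⟧ P? xs

0<∑⇒∃ : (xs : List A) (f : A → ℕ) → 0 < ∑ xs f → ∃ λ x → 0 < f x
0<∑⇒∃ (x ∷ xs) f 0<∑ with f x in eq
... | zero = 0<∑⇒∃ xs f 0<∑
... | suc _ = x , subst (0 <_) (sym eq) z<s

∈⇒≤∑ : (xs : List A) (f : A → ℕ) → ∀ {x} → x ∈ xs → f x ≤ ∑ xs f
∈⇒≤∑ (x ∷ xs) f (here refl) = m≤m+n (f x) _
∈⇒≤∑ (x ∷ xs) f (there y∈xs) = ≤-trans (∈⇒≤∑ xs f y∈xs) (m≤n+m _ (f x))

-- Cardinalities of predicates on finite sets.

-- Two duplicate-free lists with the same members are permutations of each other.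
cardinality-unique : {P : Pred A 0ℓ} {m n : ℕ} → HasCardinality P m → HasCardinality P n → m ≡ n
cardinality-unique (xs , xs! , xs⇔P , refl) (ys , ys! , ys⇔P , refl) =
  ↭-length (∼bag⇒↭ (unique∧set⇒bag xs! ys! λ {x} → mk⇔
    (Equivalence.from (ys⇔P x) ∘ Equivalence.to (xs⇔P x))
    (Equivalence.from (xs⇔P x) ∘ Equivalence.to (ys⇔P x))))

module FiniteSet {A : Set} (finite : Finite A) where

  private
    n = proj₁ finite
    module ↔ = Inverse (proj₂ finite)

  elements : List A
  elements = tabulate ↔.from

  elements-complete : ∀ x → x ∈ elements
  elements-complete x = subst (_∈ elements) (↔.strictlyInverseʳ x) (∈-tabulate⁺ (↔.to x))

  elements-unique : Unique elements
  elements-unique = tabulate⁺ λ {i} {j} eq →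
    trans (sym (↔.strictlyInverseˡ i)) (trans (cong ↔.to eq) (↔.strictlyInverseˡ j))

  infix 4 _≟ᶠ_
  _≟ᶠ_ : DecidableEquality A
  _≟ᶠ_ = inj⇒≟ (Inverse⇒Injection (proj₂ finite))

  module _ {P : Pred A 0ℓ} (P? : Decidable P) where

    ∃? : Dec (∃ P)
    ∃? = map′ (λ h → let x , _ , Px = find h in x , Px)
              (λ (x , Px) → lose (elements-complete x) Px) (any? P? elements)

    filter-cardinality : HasCardinality P (length (filter P? elements))
    filter-cardinality =
      filter P? elements , filter⁺ P? elements-unique ,
      (λ x → mk⇔ (proj₂ ∘ ∈-filter⁻ P? {xs = elements}) (∈-filter⁺ P? (elements-complete x))) , refl

    ∑⇒cardinality : ∀ {c} → ∑[ x ∈ elements ] ⟦ P? x ⟧ ≡ c → HasCardinality P c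
    ∑⇒cardinality eq =
      subst (HasCardinality P) (trans (sym (∑-⟦⟧ P? elements)) eq) filter-cardinality

    cardinality⇒∑ : ∀ {c} → HasCardinality P c → ∑[ x ∈ elements ] ⟦ P? x ⟧ ≡ c
    cardinality⇒∑ h = trans (∑-⟦⟧ P? elements) (cardinality-unique filter-cardinality h)

    ∑≤1 : (∀ x y → P x → P y → x ≡ y) → ∑[ x ∈ elements ] ⟦ P? x ⟧ ≤ 1
    ∑≤1 unique rewrite ∑-⟦⟧ P? elements with filter-cardinality
    ... | xs , xs! , xs⇔P , eq rewrite sym eq = go xs xs! (λ x → Equivalence.to (xs⇔P x))
      where
      go : ∀ ys → Unique ys → (∀ x → x ∈ ys → P x) → length ys ≤ 1
      go [] _ _ = z≤n
      go (_ ∷ []) _ _ = ≤-refl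
      go (x ∷ y ∷ _) ((x≢y ∷ _) ∷ _) all =
        contradiction (unique x y (all x (here refl)) (all y (there (here refl)))) x≢y

    ∑≡1 : ∀ x → P x → (∀ y → P y → x ≡ y) → ∑[ x ∈ elements ] ⟦ P? x ⟧ ≡ 1
    ∑≡1 x Px unique = cardinality⇒∑ (x ∷ [] , [] ∷ [] ,
      (λ y → mk⇔ (λ { (here refl) → Px }) (here ∘ sym ∘ unique y)) , refl)

-- Incidence graphs, with points and lines treated alike.

-- Only graph properties invariant under duality are assumed, and `side` does not say which side
-- holds the points. Each argument thus covers ovoids and spreads at once.
module Incidence (G : Graph) (side : Graph.V G → Bool) (q : ℕ) (1≤q : 1 ≤ q)
  (someVertex : Graph.V G)
  (bipartite : ∀ {u v} → Graph.Adj G u v → side v ≡ not (side u))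
  (degree : ∀ v → HasCardinality (Graph.Adj G v) (suc q))
  (diameter≤4 : ∀ u v → DistanceAtMost G u v 4)
  (no-4-cycle : ∀ {a b c d} → Graph.Adj G a b → Graph.Adj G b c → Graph.Adj G c d →
                Graph.Adj G d a → a ≢ c → b ≡ d)
  (no-6-cycle : ¬ HasCycleOfLength G 6)
  where

  open Graph G renaming (sym to adj-sym)
  open FiniteSet finite renaming (_≟ᶠ_ to _≟_; elements to vertices)
  open DecMembership _≟_ using (_∈?_)

  k m n : ℕ
  k = suc q
  m = q ^ 2 + 1
  n = k * m

  ∑ᵥ : (V → ℕ) → ℕ
  ∑ᵥ = ∑ vertices

  infix 5 ∑ᵥ
  syntax ∑ᵥ (λ v → e) = ∑[ v ] e

  adj : V → V → ℕ
  adj v w = ⟦ adj? v w ⟧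

  adj-comm : ∀ v w → adj v w ≡ adj w v
  adj-comm v w = ⟦⟧-⇔ (adj? v w) (adj? w v) adj-sym adj-sym

  ∑-adj : ∀ v → ∑[ w ] adj v w ≡ k
  ∑-adj v = cardinality⇒∑ (adj? v) (degree v)

  -- Sums over edges are written as sums over all pairs weighted by `adj`; terms of non-adjacent
  -- pairs vanish, so a bound is needed on edges only.
  adj-pointwise : ∀ {v w} {x y : ℕ} → (Adj v w → x ≤ y) → adj v w * x ≤ adj v w * y
  adj-pointwise {v} {w} x≤y with adj? v w
  ... | yes vw = +-monoˡ-≤ 0 (x≤y vw)
  ... | no _ = z≤n

  ∃-neighbour : ∀ v → ∃ (Adj v)
  ∃-neighbour v with degree v
  ... | w ∷ _ , _ , ws⇔ , _ = w , Equivalence.to (ws⇔ w) (here refl)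

  adj⇒side-≢ : ∀ {u v} → Adj u v → side u ≢ side v
  adj⇒side-≢ {u} uv eq with side u | bipartite uv
  ... | true | eq′ = contradiction (trans eq eq′) λ ()
  ... | false | eq′ = contradiction (trans eq eq′) λ ()

  adj²⇒side-≡ : ∀ {u v w} → Adj u v → Adj v w → side u ≡ side w
  adj²⇒side-≡ {u} uv vw = sym (trans (bipartite vw) (trans (cong not (bipartite uv)) (not-involutive (side u))))

  -- Distinctness is assumed only for pairs two steps apart on the cycle. Pairs one or three steps
  -- apart lie on different sides, hence differ anyway.
  hexagon-free : ∀ {a b c d e f} → Adj a b → Adj b c → Adj c d → Adj d e → Adj e f → Adj f a →
    a ≢ c → a ≢ e → c ≢ e → b ≢ d → b ≢ f → ¬ d ≢ f
  hexagon-free {a} {b} {c} {d} {e} {f} ab bc cd de ef fa a≢c a≢e c≢e b≢d b≢f d≢f =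
    no-6-cycle (5 , refl , Vec.lookup cycle , record
      { 3≤length = s≤s (s≤s (s≤s z≤n))
      ; distinct = λ {i} {j} → lookup-injective unique i j
      ; step = λ { 0F → ab ; 1F → bc ; 2F → cd ; 3F → de ; 4F → ef }
      ; close = fa
      })
    where
    cycle : Vec V 6
    cycle = a ∷ b ∷ c ∷ d ∷ e ∷ f ∷ []
    edge : ∀ {u v} → Adj u v → u ≢ v
    edge uv refl = irrefl refl uv
    path : ∀ {u v w x} → Adj u v → Adj v w → Adj w x → u ≢ x
    path uv vw wx refl = adj⇒side-≢ wx (sym (adj²⇒side-≡ uv vw))
    unique = (edge ab ∷ a≢c ∷ path ab bc cd ∷ a≢e ∷ (edge fa ∘ sym) ∷ [])
      ∷ (edge bc ∷ b≢d ∷ path bc cd de ∷ b≢f ∷ [])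
      ∷ (edge cd ∷ c≢e ∷ path cd de ef ∷ [])
      ∷ (edge de ∷ d≢f ∷ [])
      ∷ (edge ef ∷ [])
      ∷ [] ∷ []

  -- Walks of length two and three, and the size of a side.

  -- Collinearity of points, or concurrency of lines. It is reflexive, since every vertex has a
  -- neighbour.
  Joined : V → V → Set
  Joined u v = ∃ λ w → Adj u w × Adj w v

  joined? : ∀ u v → Dec (Joined u v)
  joined? u v = ∃? λ w → adj? u w ×-dec adj? w v

  -- The square of the adjacency matrix. Off the diagonal, two common neighbours would give a
  -- 4-cycle; on it, the degree `1 + q` splits into 1 for `Joined u u` and `q` for the correction.
  common-neighbours : ∀ u v →
    ∑[ w ] (adj u w * adj w v) ≡ ⟦ joined? u v ⟧ + q * ⟦ u ≟ v ⟧
  common-neighbours u v with u ≟ v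
  ... | yes refl = begin
      ∑[ w ] (adj u w * adj w u)  ≡⟨ ∑-cong vertices same ⟩
      ∑[ w ] adj u w              ≡⟨ ∑-adj u ⟩
      1 + q
        ≡⟨ cong₂ _+_ (sym (⟦⟧-yes (joined? u u) (w , uw , adj-sym uw))) (sym (*-identityʳ q)) ⟩
      ⟦ joined? u u ⟧ + q * 1     ∎
    where
    open ≡-Reasoning
    w = proj₁ (∃-neighbour u)
    uw = proj₂ (∃-neighbour u)
    same : ∀ w → adj u w * adj w u ≡ adj u w
    same w rewrite adj-comm w u with adj? u w
    ... | yes _ = refl
    ... | no _ = refl
  ... | no u≢v = begin
      ∑[ w ] (adj u w * adj w v)           ≡⟨ ∑-cong vertices (λ w → ⟦⟧-× (adj? u w) (adj? w v)) ⟩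
      ∑[ w ] ⟦ adj? u w ×-dec adj? w v ⟧   ≡⟨ count (joined? u v) ⟩
      ⟦ joined? u v ⟧                      ≡⟨ sym (+-identityʳ _) ⟩
      ⟦ joined? u v ⟧ + 0                  ≡⟨ cong (⟦ joined? u v ⟧ +_) (sym (*-zeroʳ q)) ⟩
      ⟦ joined? u v ⟧ + q * 0              ∎
    where
    open ≡-Reasoning
    count : (d : Dec (Joined u v)) → ∑[ w ] ⟦ adj? u w ×-dec adj? w v ⟧ ≡ ⟦ d ⟧
    count (yes (w , uw , wv)) = ∑≡1 (λ w → adj? u w ×-dec adj? w v) w (uw , wv)
      λ w′ (uw′ , w′v) → no-4-cycle uw wv (adj-sym w′v) (adj-sym uw′) u≢v
    count (no ¬j) = trans
      (∑-cong vertices λ w → ⟦⟧-no (adj? u w ×-dec adj? w v) λ h → ¬j (w , h)) (∑-zero vertices)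

  ∑-≟ : ∀ u → ∑[ v ] ⟦ u ≟ v ⟧ ≡ 1
  ∑-≟ u = ∑≡1 (u ≟_) u refl λ _ eq → eq

  -- There are `k * k` walks of length two from `u`. Each joined vertex is reached once, except `u`
  -- itself, which is reached `q` more times; `q` stands on the left to avoid subtraction.
  ∑-joined : ∀ u → (∑[ v ] ⟦ joined? u v ⟧) + q ≡ k * k
  ∑-joined u = begin
    (∑[ v ] ⟦ joined? u v ⟧) + q
      ≡⟨ cong ((∑[ v ] ⟦ joined? u v ⟧) +_) (sym (trans (cong (q *_) (∑-≟ u)) (*-identityʳ q))) ⟩
    (∑[ v ] ⟦ joined? u v ⟧) + q * (∑[ v ] ⟦ u ≟ v ⟧)
      ≡⟨ cong ((∑[ v ] ⟦ joined? u v ⟧) +_) (sym (∑-*ˡ vertices q _)) ⟩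
    (∑[ v ] ⟦ joined? u v ⟧) + (∑[ v ] (q * ⟦ u ≟ v ⟧))      ≡⟨ sym (∑-distrib-+ vertices _ _) ⟩
    ∑[ v ] (⟦ joined? u v ⟧ + q * ⟦ u ≟ v ⟧)
      ≡⟨ ∑-cong vertices (λ v → sym (common-neighbours u v)) ⟩
    ∑[ v ] (∑[ w ] (adj u w * adj w v))                      ≡⟨ ∑-comm vertices vertices _ ⟩
    ∑[ w ] (∑[ v ] (adj u w * adj w v))
      ≡⟨ ∑-cong vertices (λ w → trans (∑-*ˡ vertices (adj u w) _) (cong (adj u w *_) (∑-adj w))) ⟩
    ∑[ w ] (adj u w * k)                                     ≡⟨ ∑-*ʳ vertices (adj u) k ⟩
    (∑[ w ] adj u w) * k                                     ≡⟨ cong (_* k) (∑-adj u) ⟩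
    k * k                                                    ∎
    where open ≡-Reasoning

  -- The distance is at most 4 and odd by the choice of sides; length 1 is excluded, so 3 remains.
  ∃-3-walk : ∀ u v → side u ≢ side v → ¬ Adj u v → ∃ λ w → Adj u w × Joined w v
  ∃-3-walk u v u≢v ¬uv with diameter≤4 u v
  ... | _ , ([] , _) , _ = contradiction refl u≢v
  ... | _ , (uv ∷ [] , _) , _ = contradiction uv ¬uv
  ... | _ , (a ∷ (b ∷ []) , _) , _ = contradiction (adj²⇒side-≡ a b) u≢v
  ... | _ , (a ∷ (b ∷ (c ∷ [])) , _) , _ = _ , a , _ , b , c
  ... | _ , (a ∷ (b ∷ (c ∷ (d ∷ []))) , _) , _ =
    contradiction (trans (adj²⇒side-≡ a b) (adj²⇒side-≡ c d)) u≢v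
  ... | _ , (_ ∷ (_ ∷ (_ ∷ (_ ∷ (_ ∷ _)))) , _) , s≤s (s≤s (s≤s (s≤s ())))

  -- The axiom of generalized quadrangles: a line not on a point carries
  -- exactly one point collinear with it.
  neighbours-joined : ∀ l p →
    ∑[ a ] (adj l a * ⟦ joined? a p ⟧) ≡ ⟦ side p ≟ᵇ not (side l) ⟧ + q * adj l p
  neighbours-joined l p with side p ≟ᵇ not (side l)
  ... | no ¬opp = trans (trans (∑-cong vertices zeros) (∑-zero vertices))
                        (sym (trans (cong (q *_) (⟦⟧-no (adj? l p) (¬opp ∘ bipartite))) (*-zeroʳ q)))
    where
    zeros : ∀ a → adj l a * ⟦ joined? a p ⟧ ≡ 0
    zeros a = trans (⟦⟧-× (adj? l a) (joined? a p))
      (⟦⟧-no (adj? l a ×-dec joined? a p) λ (la , _ , ab , bp) →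
        ¬opp (trans (sym (adj²⇒side-≡ ab bp)) (bipartite la)))
  ... | yes opp with adj? l p
  -- When `p` lies on `l`, all `1 + q` neighbours of `l` are joined to `p` through `l`, which is why
  -- `q * adj l p` is added.
  ... | yes lp = begin
      ∑[ a ] (adj l a * ⟦ joined? a p ⟧)  ≡⟨ ∑-cong vertices all-joined ⟩
      ∑[ a ] adj l a                      ≡⟨ ∑-adj l ⟩
      1 + q                               ≡⟨ cong suc (sym (*-identityʳ q)) ⟩
      1 + q * 1                           ∎
    where
    open ≡-Reasoning
    all-joined : ∀ a → adj l a * ⟦ joined? a p ⟧ ≡ adj l a
    all-joined a with adj? l a
    ... | yes la = trans (+-identityʳ _) (⟦⟧-yes (joined? a p) (l , adj-sym la , lp))
    ... | no _ = refl
  ... | no ¬lp = begin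
      ∑[ a ] (adj l a * ⟦ joined? a p ⟧)
        ≡⟨ ∑-cong vertices (λ a → ⟦⟧-× (adj? l a) (joined? a p)) ⟩
      ∑[ a ] ⟦ adj? l a ×-dec joined? a p ⟧
        ≡⟨ ∑≡1 (λ a → adj? l a ×-dec joined? a p) (proj₁ walk) (proj₂ walk) (unique (proj₂ walk)) ⟩
      1                                         ≡⟨ cong suc (sym (*-zeroʳ q)) ⟩
      1 + q * 0                                 ∎
    where
    open ≡-Reasoning
    walk = ∃-3-walk l p (λ eq → not-¬ refl (trans eq opp)) ¬lp
    -- Two such neighbours `a` and `a′` reach `p` through `b` and `b′`. If `b` and `b′` agree, the
    -- absence of 4-cycles identifies `a` with `a′`; otherwise `l a b p b′ a′` is a hexagon.
    unique : ∀ {a} → Adj l a × Joined a p → ∀ a′ → Adj l a′ × Joined a′ p → a ≡ a′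
    unique {a} (la , b , ab , bp) a′ (la′ , b′ , a′b′ , b′p) with a ≟ a′ | b ≟ b′
    ... | yes eq | _ = eq
    ... | no a≢a′ | yes refl = no-4-cycle la ab (adj-sym a′b′) (adj-sym la′) λ { refl → ¬lp bp }
    ... | no a≢a′ | no b≢b′ = contradiction b≢b′ λ b≢b′ →
      hexagon-free la ab bp (adj-sym b′p) (adj-sym a′b′) (adj-sym la′)
        (λ { refl → ¬lp bp }) (λ { refl → ¬lp b′p }) b≢b′
        (λ { refl → ¬lp la }) a≢a′ (λ { refl → ¬lp la′ })

  ∃-on-side : ∀ s → ∃ λ v → side v ≡ s
  ∃-on-side s with side someVertex ≟ᵇ s
  ... | yes eq = someVertex , eq
  ... | no ≢s with w , vw ← ∃-neighbour someVertex =
    w , trans (bipartite vw) (sym (¬-not (≢s ∘ sym)))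

  -- Fix `l` on the other side and sum `neighbours-joined` over all `p`. One count gives
  -- `c + q * k`, the other `k * (k * k - q)` by `∑-joined`. Adding `k * q` to both clears the
  -- subtraction, and `cube` solves for `c`.
  ∑-side : ∀ s → ∑[ v ] ⟦ side v ≟ᵇ s ⟧ ≡ n
  ∑-side s with l , l≡ ← ∃-on-side (not s) = +-cancelʳ-≡ (q * k + k * q) _ _ (begin
    c + (q * k + k * q)                                  ≡⟨ sym (+-assoc c _ _) ⟩
    c + q * k + k * q                                    ≡⟨ cong (_+ k * q) (begin
      c + q * k
        ≡⟨ cong₂ _+_ (∑-cong vertices λ p → cong (λ t → ⟦ side p ≟ᵇ t ⟧) (sym s≡)) (cong (q *_) (sym (∑-adj l))) ⟩
      (∑[ p ] ⟦ opp p ⟧) + q * (∑[ p ] adj l p)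
        ≡⟨ cong ((∑[ p ] ⟦ opp p ⟧) +_) (sym (∑-*ˡ vertices q _)) ⟩
      (∑[ p ] ⟦ opp p ⟧) + (∑[ p ] (q * adj l p))            ≡⟨ sym (∑-distrib-+ vertices _ _) ⟩
      ∑[ p ] (⟦ opp p ⟧ + q * adj l p)
        ≡⟨ ∑-cong vertices (λ p → sym (neighbours-joined l p)) ⟩
      ∑[ p ] (∑[ a ] (adj l a * ⟦ joined? a p ⟧))            ≡⟨ ∑-comm vertices vertices _ ⟩
      ∑[ a ] (∑[ p ] (adj l a * ⟦ joined? a p ⟧))
        ≡⟨ ∑-cong vertices (λ a → ∑-*ˡ vertices (adj l a) _) ⟩
      ∑[ a ] (adj l a * J a)                                 ∎) ⟩
    (∑[ a ] (adj l a * J a)) + k * q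
      ≡⟨ cong ((∑[ a ] (adj l a * J a)) +_) (trans (cong (_* q) (sym (∑-adj l))) (sym (∑-*ʳ vertices (adj l) q))) ⟩
    (∑[ a ] (adj l a * J a)) + (∑[ a ] (adj l a * q))    ≡⟨ sym (∑-distrib-+ vertices _ _) ⟩
    ∑[ a ] (adj l a * J a + adj l a * q)
      ≡⟨ ∑-cong vertices (λ a → trans (sym (*-distribˡ-+ (adj l a) (J a) q)) (cong (adj l a *_) (∑-joined a))) ⟩
    ∑[ a ] (adj l a * (k * k))                           ≡⟨ ∑-*ʳ vertices (adj l) (k * k) ⟩
    (∑[ a ] adj l a) * (k * k)                           ≡⟨ cong (_* (k * k)) (∑-adj l) ⟩
    k * (k * k)                                          ≡⟨ cube q ⟩
    n + (q * k + k * q)                                  ∎)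
    where
    open ≡-Reasoning
    c = ∑[ v ] ⟦ side v ≟ᵇ s ⟧
    opp = λ p → side p ≟ᵇ not (side l)
    J = λ a → ∑[ p ] ⟦ joined? a p ⟧
    s≡ : not (side l) ≡ s
    s≡ = trans (cong not l≡) (not-involutive s)
    cube : ∀ q → suc q * (suc q * suc q) ≡ suc q * (q * (q * 1) + 1) + (q * suc q + suc q * q)
    cube = solve-∀

  ∑-vertices : ∑[ v ] 1 ≡ n + n
  ∑-vertices = begin
    ∑[ v ] 1
      ≡⟨ ∑-cong vertices (split ∘ side) ⟩
    ∑[ v ] (⟦ side v ≟ᵇ true ⟧ + ⟦ side v ≟ᵇ false ⟧)                   ≡⟨ ∑-distrib-+ vertices _ _ ⟩
    (∑[ v ] ⟦ side v ≟ᵇ true ⟧) + (∑[ v ] ⟦ side v ≟ᵇ false ⟧)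
      ≡⟨ cong₂ _+_ (∑-side true) (∑-side false) ⟩
    n + n                                                               ∎
    where
    open ≡-Reasoning
    split : ∀ b → 1 ≡ ⟦ b ≟ᵇ true ⟧ + ⟦ b ≟ᵇ false ⟧
    split true = refl
    split false = refl

  -- Double counting over edges.

  ∑-adj-right : ∀ (g : V → ℕ) → ∑[ v ] (∑[ w ] (adj v w * g w)) ≡ k * ∑ᵥ g
  ∑-adj-right g = begin
    ∑[ v ] (∑[ w ] (adj v w * g w))   ≡⟨ ∑-comm vertices vertices _ ⟩
    ∑[ w ] (∑[ v ] (adj v w * g w))
      ≡⟨ ∑-cong vertices (λ w → trans (∑-*ʳ vertices (λ v → adj v w) (g w))
                                          (cong (_* g w) (trans (∑-cong vertices λ v → adj-comm v w) (∑-adj w)))) ⟩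
    ∑[ w ] (k * g w)                  ≡⟨ ∑-*ˡ vertices k g ⟩
    k * ∑ᵥ g                          ∎
    where open ≡-Reasoning

  ∑-adj-left : ∀ (g : V → ℕ) → ∑[ v ] (∑[ w ] (adj v w * g v)) ≡ k * ∑ᵥ g
  ∑-adj-left g = trans (∑-comm vertices vertices _)
    (trans (∑-cong vertices λ w → ∑-cong vertices λ v → cong (_* g v) (adj-comm v w)) (∑-adj-right g))

  -- The sum runs over ordered pairs, so each edge counts twice; `m+m≤n+n⇒m≤n` later halves the
  -- resulting inequalities.
  ∑-edges : ∀ (g : V → ℕ) → ∑[ v ] (∑[ w ] (adj v w * (g v + g w))) ≡ k * ∑ᵥ g + k * ∑ᵥ g
  ∑-edges g = begin
    ∑[ v ] (∑[ w ] (adj v w * (g v + g w)))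
      ≡⟨ ∑-cong vertices (λ v → trans (∑-cong vertices λ w → *-distribˡ-+ (adj v w) (g v) (g w)) (∑-distrib-+ vertices _ _)) ⟩
    ∑[ v ] ((∑[ w ] (adj v w * g v)) + (∑[ w ] (adj v w * g w)))
      ≡⟨ ∑-distrib-+ vertices _ _ ⟩
    (∑[ v ] (∑[ w ] (adj v w * g v))) + (∑[ v ] (∑[ w ] (adj v w * g w)))
      ≡⟨ cong₂ _+_ (∑-adj-left g) (∑-adj-right g) ⟩
    k * ∑ᵥ g + k * ∑ᵥ g                                                        ∎
    where open ≡-Reasoning

  ∑-edges-one : ∑[ v ] (∑[ w ] (adj v w * 1)) ≡ k * n + k * n
  ∑-edges-one = trans (∑-adj-right (λ _ → 1)) (trans (cong (k *_) ∑-vertices) (*-distribˡ-+ k n n))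

  -- The weight `g` need not be given as the indicator of a set: besides colour 1, it is applied to
  -- the number of neighbours in a set.
  module _ {g : V → ℕ} (independent : ∀ {v w} → Adj v w → g v + g w ≤ 1) where

    independent≤n : ∑ᵥ g ≤ n
    independent≤n = *-cancelˡ-≤ k (m+m≤n+n⇒m≤n (begin
      k * ∑ᵥ g + k * ∑ᵥ g                       ≡⟨ sym (∑-edges g) ⟩
      ∑[ v ] (∑[ w ] (adj v w * (g v + g w)))
        ≤⟨ ∑-mono vertices (λ v → ∑-mono vertices λ w → adj-pointwise independent) ⟩
      ∑[ v ] (∑[ w ] (adj v w * 1))             ≡⟨ ∑-edges-one ⟩
      k * n + k * n                             ∎))
      where open ≤-Reasoning

    independent-tight : ∑ᵥ g ≡ n → ∀ {v w} → Adj v w → g v + g w ≡ 1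
    independent-tight ∑g≡n {v} {w} vw =
      trans (sym (*-identityˡ _)) (subst (λ t → t * (g v + g w) ≡ t * 1) (⟦⟧-yes (adj? v w) vw)
        -- Tightness is used twice: first the outer sum yields equality of the inner sums at `v`,
        -- then the inner sum yields equality at `w`.
        (∑-tight vertices (λ w → adj-pointwise independent)
          (≤-reflexive (sym (∑-tight vertices (λ v → ∑-mono vertices λ w → adj-pointwise independent)
            (≤-reflexive (trans ∑-edges-one (trans (cong (λ t → k * t + k * t) (sym ∑g≡n)) (sym (∑-edges g)))))
            (elements-complete v))))
          (elements-complete w)))

  -- An edge has total weight at most 1 unless it joins the `g`-set to the `h`-set, where it has
  -- weight 2. The products `g v * h w` and `g w * h v` detect these exceptional edges, and each
  -- vertex of the `g`-set is on at most one of them.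
  independent-and-2-packing : (g h : V → ℕ) →
    (∀ v → g v + h v ≤ 1) →
    (∀ {v w} → Adj v w → g v + g w ≤ 1) →
    (∀ v → ∑[ w ] (adj v w * h w) ≤ 1) →
    (∀ {v w} → Adj v w → h v + h w ≤ 1) →
    k * (∑ᵥ g + ∑ᵥ h) ≤ k * n + ∑ᵥ g
  independent-and-2-packing g h disjoint independent packing packing′ = m+m≤n+n⇒m≤n (begin
    k * (∑ᵥ g + ∑ᵥ h) + k * (∑ᵥ g + ∑ᵥ h)
      ≡⟨ cong (λ t → k * t + k * t) (sym (∑-distrib-+ vertices g h)) ⟩
    k * ∑ᵥ c + k * ∑ᵥ c
      ≡⟨ sym (∑-edges c) ⟩
    ∑[ v ] (∑[ w ] (adj v w * (c v + c w)))
      ≤⟨ ∑-mono vertices (λ v → ∑-mono vertices λ w → adj-pointwise (edge v w)) ⟩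
    ∑[ v ] (∑[ w ] (adj v w * (1 + (g v * h w + g w * h v))))
      ≡⟨ ∑-cong vertices (λ v → trans (∑-cong vertices λ w → expand v w) (trans (∑-distrib-+ vertices _ _) (cong ((∑[ w ] (adj v w * 1)) +_) (∑-distrib-+ vertices _ _)))) ⟩
    ∑[ v ] ((∑[ w ] (adj v w * 1)) + (X v + Y v))
      ≡⟨ trans (∑-distrib-+ vertices _ _) (cong ((∑[ v ] (∑[ w ] (adj v w * 1))) +_) (∑-distrib-+ vertices X Y)) ⟩
    (∑[ v ] (∑[ w ] (adj v w * 1))) + (∑ᵥ X + ∑ᵥ Y)
      ≡⟨ cong₂ _+_ ∑-edges-one (cong (∑ᵥ X +_) Y≡X) ⟩
    k * n + k * n + (∑ᵥ X + ∑ᵥ X)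
      ≤⟨ +-monoʳ-≤ (k * n + k * n) (+-mono-≤ X≤g X≤g) ⟩
    k * n + k * n + (∑ᵥ g + ∑ᵥ g)
      ≡⟨ shuffle (k * n) (∑ᵥ g) ⟩
    k * n + ∑ᵥ g + (k * n + ∑ᵥ g) ∎)
    where
    open ≤-Reasoning
    c X Y : V → ℕ
    c v = g v + h v
    X v = ∑[ w ] (g v * (adj v w * h w))
    Y v = ∑[ w ] (g w * (adj w v * h v))
    Y≡X : ∑ᵥ Y ≡ ∑ᵥ X
    Y≡X = ∑-comm vertices vertices (λ v w → g w * (adj w v * h v))
    X≤g : ∑ᵥ X ≤ ∑ᵥ g
    X≤g = ∑-mono vertices λ v → begin
      X v                                  ≡⟨ ∑-*ˡ vertices (g v) _ ⟩
      g v * (∑[ w ] (adj v w * h w))       ≤⟨ *-monoʳ-≤ (g v) (packing v) ⟩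
      g v * 1                              ≡⟨ *-identityʳ (g v) ⟩
      g v                                  ∎
    shuffle : ∀ x y → x + x + (y + y) ≡ x + y + (x + y)
    shuffle = solve-∀
    expand′ : ∀ a p r s t → a * (1 + (p * r + s * t)) ≡ a * 1 + (p * (a * r) + s * (a * t))
    expand′ = solve-∀
    -- Writing `adj w v` in the last term makes `Y` the transpose of `X`, so that exchanging the
    -- sums gives `Y≡X`.
    expand : ∀ v w → adj v w * (1 + (g v * h w + g w * h v)) ≡ adj v w * 1 + (g v * (adj v w * h w) + g w * (adj w v * h v))
    expand v w rewrite adj-comm w v = expand′ (adj v w) (g v) (h w) (g w) (h v)
    -- The hypotheses force all four numbers to be 0 or 1, leaving a finite check.
    bits : ∀ a b a′ b′ → a + b ≤ 1 → a′ + b′ ≤ 1 → a + a′ ≤ 1 → b + b′ ≤ 1 →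
      a + b + (a′ + b′) ≤ 1 + (a * b′ + a′ * b)
    bits 0 0 a′ b′ _ r _ _ = ≤-trans r (m≤m+n 1 _)
    bits 0 1 0 0 _ _ _ _ = ≤-refl
    bits 0 1 0 (suc _) _ _ _ (s≤s ())
    bits 0 1 1 0 _ _ _ _ = ≤-refl
    bits 0 1 1 (suc _) _ (s≤s ()) _ _
    bits 0 1 (suc (suc _)) _ _ _ (s≤s ()) _
    bits 0 (suc (suc _)) _ _ (s≤s ()) _ _ _
    bits 1 0 0 0 _ _ _ _ = ≤-refl
    bits 1 0 0 1 _ _ _ _ = ≤-refl
    bits 1 0 0 (suc (suc _)) _ (s≤s ()) _ _
    bits 1 0 (suc _) _ _ _ (s≤s ()) _
    bits 1 (suc _) _ _ (s≤s ()) _ _ _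
    bits (suc (suc _)) _ _ _ (s≤s ()) _ _ _
    edge : ∀ v w → Adj v w → c v + c w ≤ 1 + (g v * h w + g w * h v)
    edge v w vw = bits (g v) (h v) (g w) (h w) (disjoint v) (disjoint w) (independent vw) (packing′ vw)

  -- Spaced sets and ovoidal sets.

  -- Distance is a relation, so a shortest walk must first be supplied; the diameter bound does
  -- this.
  distance≤ : ∀ {u v i} → Walk G u v i → DistanceAtMost G u v i
  distance≤ {u} {v} {i} walk with d , dist@(_ , least) , _ ← diameter≤4 u v = d , dist , least i walk

  Spaced : ℕ → Pred V 0ℓ → Set
  Spaced i P = ∀ {u v} → P u → P v → u ≢ v → DistanceAtLeast G u v i

  -- The common form of ovoids and spreads: `t` selects the side, so one value gives ovoids and the
  -- other spreads.
  record IsOvoidal (t : Bool) (P : Pred V 0ℓ) : Set where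
    field
      size     : HasCardinality P m
      on-side  : ∀ {v} → P v → side v ≡ t
      opposite : ∀ {u v} → P u → P v → u ≢ v → Distance G u v 4
      covering : ∀ v → ∃ λ w → P w × DistanceAtMost G v w 2

  walk⇒≡ : ∀ {P i j u v} → Spaced i P → P u → P v → Walk G u v j → j < i → u ≡ v
  walk⇒≡ {u = u} {v} spaced Pu Pv walk j<i with u ≟ v
  ... | yes eq = eq
  ... | no u≢v with d , dist , d≤j ← distance≤ walk =
    contradiction (≤-trans (spaced Pu Pv u≢v d dist) d≤j) (<⇒≱ j<i)

  same-side-spaced : ∀ {t P} → (∀ {v} → P v → side v ≡ t) → Spaced 2 P
  same-side-spaced on-side Pu Pv u≢v _ ([] , _) = contradiction refl u≢v
  same-side-spaced on-side Pu Pv u≢v _ (uv ∷ [] , _) =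
    contradiction (trans (on-side Pu) (sym (on-side Pv))) (adj⇒side-≢ uv)
  same-side-spaced on-side Pu Pv u≢v _ (_ ∷ (_ ∷ _) , _) = s≤s (s≤s z≤n)

  -- Distances within a side are even and at most 4, so a lower bound of 3 already forces 4.
  same-side-opposite : ∀ {u v} → side u ≡ side v → u ≢ v → DistanceAtLeast G u v 3 → Distance G u v 4
  same-side-opposite {u} {v} eq u≢v far with diameter≤4 u v
  ... | _ , ([] , _) , _ = contradiction refl u≢v
  ... | _ , (a ∷ [] , _) , _ = contradiction eq (adj⇒side-≢ a)
  ... | _ , dist@(_ ∷ (_ ∷ []) , _) , _ = contradiction (far _ dist) λ { (s≤s (s≤s ())) }
  ... | _ , (a ∷ (b ∷ (c ∷ [])) , _) , _ =
    contradiction (trans (sym eq) (adj²⇒side-≡ a b)) (adj⇒side-≢ c ∘ sym)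
  ... | _ , dist@(_ ∷ (_ ∷ (_ ∷ (_ ∷ []))) , _) , _ = dist
  ... | _ , (_ ∷ (_ ∷ (_ ∷ (_ ∷ (_ ∷ _)))) , _) , s≤s (s≤s (s≤s (s≤s ())))

  module _ {P : Pred V 0ℓ} (P? : Decidable P) where

    neighboursIn : V → ℕ
    neighboursIn v = ∑[ w ] (adj v w * ⟦ P? w ⟧)

    neighboursIn⇒∃ : ∀ v → 0 < neighboursIn v → ∃ λ w → Adj v w × P w
    neighboursIn⇒∃ v 0<N with w , 0<t ← 0<∑⇒∃ vertices _ 0<N =
      w , ⟦⟧-true (adj? v w ×-dec P? w) (subst (0 <_) (⟦⟧-× (adj? v w) (P? w)) 0<t)

    module _ (spaced : Spaced 3 P) where

      neighboursIn≤1 : ∀ v → neighboursIn v ≤ 1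
      neighboursIn≤1 v = ≤-trans
        (≤-reflexive (∑-cong vertices λ w → ⟦⟧-× (adj? v w) (P? w)))
        (∑≤1 (λ w → adj? v w ×-dec P? w) λ x y (vx , Px) (vy , Py) →
          walk⇒≡ spaced Px Py (adj-sym vx ∷ (vy ∷ [])) ≤-refl)

      module _ {t : Bool} (on-side : ∀ {v} → P v → side v ≡ t) (size : ∑[ v ] ⟦ P? v ⟧ ≡ m) where

        neighboursIn≤opposite : ∀ v → neighboursIn v ≤ ⟦ side v ≟ᵇ not t ⟧
        neighboursIn≤opposite v with side v ≟ᵇ not t
        ... | yes _ = neighboursIn≤1 v
        ... | no ¬opp = ≮⇒≥ λ 0<N → let w , vw , Pw = neighboursIn⇒∃ v 0<N in
          ¬opp (trans (bipartite (adj-sym vw)) (cong not (on-side Pw)))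

        -- The `m` neighbourhoods of members of `P` are disjoint, have `k` elements each and lie in
        -- the opposite side. As that side has `n = k * m` vertices, they fill it.
        opposite⇒neighbour : ∀ v → side v ≡ not t → ∃ λ w → Adj v w × P w
        opposite⇒neighbour v opp = neighboursIn⇒∃ v
          (≤-reflexive (sym (trans covered (⟦⟧-yes (side v ≟ᵇ not t) opp))))
          where
          covered = ∑-tight vertices neighboursIn≤opposite
            (≤-reflexive (trans (∑-side (not t)) (sym (trans (∑-adj-right _) (cong (k *_) size)))))
            (elements-complete v)

        spaced⇒covering : ∀ v → ∃ λ w → P w × DistanceAtMost G v w 2
        spaced⇒covering v with side v ≟ᵇ not t
        ... | yes opp =
          let w , vw , Pw = opposite⇒neighbour v opp
              d , dist , d≤1 = distance≤ (vw ∷ [])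
          in w , Pw , d , dist , ≤-trans d≤1 (n≤1+n 1)
        -- A vertex on the side of `P` moves to an arbitrary neighbour first, which uses up the
        -- allowed distance 2.
        ... | no ¬opp =
          let u , vu = ∃-neighbour v
              side-u = trans (bipartite vu) (cong not (trans (¬-not ¬opp) (not-involutive t)))
              w , uw , Pw = opposite⇒neighbour u side-u
          in w , Pw , distance≤ (vu ∷ (uw ∷ []))

        spaced⇒ovoidal : IsOvoidal t P
        spaced⇒ovoidal = record
          { size = ∑⇒cardinality P? size
          ; on-side = on-side
          ; opposite = λ Pu Pv u≢v → same-side-opposite (trans (on-side Pu) (sym (on-side Pv))) u≢v (spaced Pu Pv u≢v)
          ; covering = spaced⇒covering
          }

    -- The neighbourhood of `P` is independent and has `k` times as many vertices as `P`, so
    -- `independent≤n` bounds it by `n = k * m`.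
    spaced4≤m : Spaced 4 P → ∑[ v ] ⟦ P? v ⟧ ≤ m
    spaced4≤m spaced = *-cancelˡ-≤ k (≤-trans (≤-reflexive (sym (∑-adj-right _))) (independent≤n independent))
      where
      spaced3 : Spaced 3 P
      spaced3 Pu Pv u≢v d dist = ≤-trans (n≤1+n 3) (spaced Pu Pv u≢v d dist)
      independent : ∀ {v w} → Adj v w → neighboursIn v + neighboursIn w ≤ 1
      independent {v} {w} vw with 0 <? neighboursIn v | 0 <? neighboursIn w
      ... | no v≯0 | _ = +-mono-≤ (≮⇒≥ v≯0) (neighboursIn≤1 spaced3 w)
      ... | yes _ | no w≯0 =
        ≤-trans (+-mono-≤ (neighboursIn≤1 spaced3 v) (≮⇒≥ w≯0)) ≤-refl
      -- The walk `x v w y` has length 3, so spacing 4 makes `x` and `y` equal, and `v`, `w` would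
      -- be adjacent with a common neighbour in a bipartite graph.
      ... | yes v>0 | yes w>0 with x , vx , Px ← neighboursIn⇒∃ v v>0 | y , wy , Py ← neighboursIn⇒∃ w w>0
        with refl ← walk⇒≡ spaced Px Py (adj-sym vx ∷ (vw ∷ (wy ∷ []))) ≤-refl =
        contradiction (adj²⇒side-≡ vx (adj-sym wy)) (adj⇒side-≢ vw)

  -- The lower bound on the number of colours.

  -- What is left of a side after removing two ovoidal sets has size `m * (q ∸ 1)`. The hypothesis
  -- `1≤q` makes the truncated subtraction exact.
  n≡rest+m+m : n ≡ m * (q ∸ 1) + (m + m)
  n≡rest+m+m = trans (cong (λ t → suc t * m) (sym (m+[n∸m]≡n 1≤q))) (expand m (q ∸ 1))
    where
    expand : ∀ m r → (2 + r) * m ≡ m * r + (m + m)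
    expand = solve-∀

  m>0 : 0 < m
  m>0 = m≤n+m 1 (q ^ 2)

  module _ {j Γ} (colouring : IsPackingColoring G j Γ) where
    open IsPackingColoring colouring

    class? : ∀ i v → Dec (Γ v ≡ i)
    class? i v = Γ v ≟ℕ i

    classSize : ℕ → ℕ
    classSize i = ∑[ v ] ⟦ class? i v ⟧

    class-spaced : ∀ i → Spaced (suc i) (λ v → Γ v ≡ i)
    class-spaced i {u} {v} Γu Γv u≢v =
      subst (DistanceAtLeast G u v) (+-comm i 1) (packing i u v u≢v Γu Γv)

    class-independent : ∀ i {v w} → 1 ≤ i → Adj v w → ⟦ class? i v ⟧ + ⟦ class? i w ⟧ ≤ 1
    class-independent i {v} {w} 1≤i vw with class? i v | class? i w
    ... | no _ | d = ⟦⟧-≤1 d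
    ... | yes _ | no _ = ≤-refl
    ... | yes Γv | yes Γw with refl ← walk⇒≡ (class-spaced i) Γv Γw (vw ∷ []) (s≤s 1≤i) =
      contradiction vw (irrefl refl)

    large-class≤1 : ∀ i → 4 ≤ i → classSize i ≤ 1
    large-class≤1 i 4≤i = ∑≤1 (class? i) λ u v Γu Γv →
      let _ , (walk , _) , d≤4 = diameter≤4 u v
      in walk⇒≡ (class-spaced i) Γu Γv walk (s≤s (≤-trans d≤4 4≤i))

    class₁≤n : classSize 1 ≤ n
    class₁≤n = independent≤n (class-independent 1 ≤-refl)

    class₁₂-edges : k * (classSize 1 + classSize 2) ≤ k * n + classSize 1
    class₁₂-edges = independent-and-2-packing _ _ disjoint
      (class-independent 1 ≤-refl) (neighboursIn≤1 (class? 2) (class-spaced 2))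
      (class-independent 2 (n≤1+n 1))
      where
      disjoint : ∀ v → ⟦ class? 1 v ⟧ + ⟦ class? 2 v ⟧ ≤ 1
      disjoint v with class? 1 v | class? 2 v
      ... | no _ | d = ⟦⟧-≤1 d
      ... | yes _ | no _ = ≤-refl
      ... | yes Γ≡1 | yes Γ≡2 = contradiction (trans (sym Γ≡1) Γ≡2) λ ()

    -- Inserting `class₁≤n` in the edge count bounds the left side by `k * n + n`, and `n = k * m`
    -- lets `k` cancel.
    class₁₂≤n+m : classSize 1 + classSize 2 ≤ n + m
    class₁₂≤n+m = *-cancelˡ-≤ k (≤-trans class₁₂-edges
      (≤-trans (+-monoʳ-≤ (k * n) class₁≤n) (≤-reflexive (sym (*-distribˡ-+ k n m)))))

    class₃≤m : classSize 3 ≤ m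
    class₃≤m = spaced4≤m (class? 3) (class-spaced 3)

    class-empty : ∀ i → j < i → classSize i ≡ 0
    class-empty i j<i = trans
      (∑-cong vertices λ v → ⟦⟧-no (class? i v) λ { refl → <⇒≱ j<i (proj₂ (range v)) })
      (∑-zero vertices)

    large-classes : ∑[ v ] (∑[ i ∈ upTo (j ∸ 3) ] ⟦ class? (4 + i) v ⟧) ≤ j ∸ 3
    large-classes = begin
      ∑[ v ] (∑[ i ∈ upTo (j ∸ 3) ] ⟦ class? (4 + i) v ⟧)   ≡⟨ ∑-comm vertices (upTo (j ∸ 3)) _ ⟩
      ∑[ i ∈ upTo (j ∸ 3) ] classSize (4 + i)
        ≤⟨ ∑-mono (upTo (j ∸ 3)) (λ i → large-class≤1 (4 + i) (m≤m+n 4 i)) ⟩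
      ∑[ i ∈ upTo (j ∸ 3) ] 1                               ≡⟨ ∑-one (upTo (j ∸ 3)) ⟩
      length (upTo (j ∸ 3))                                 ≡⟨ length-upTo (j ∸ 3) ⟩
      j ∸ 3                                                 ∎
      where open ≤-Reasoning

    vertex-count : n + n ≤ classSize 1 + classSize 2 + classSize 3 + (j ∸ 3)
    vertex-count = begin
      n + n                                                     ≡⟨ sym ∑-vertices ⟩
      ∑[ v ] 1                                                  ≤⟨ ∑-mono vertices coloured ⟩
      ∑[ v ] (c 1 v + c 2 v + c 3 v + large v)                  ≡⟨ ∑-distrib-+ vertices _ large ⟩
      (∑[ v ] (c 1 v + c 2 v + c 3 v)) + ∑ᵥ large
        ≡⟨ cong (_+ ∑ᵥ large) (trans (∑-distrib-+ vertices _ (c 3)) (cong (_+ classSize 3) (∑-distrib-+ vertices (c 1) (c 2)))) ⟩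
      classSize 1 + classSize 2 + classSize 3 + ∑ᵥ large
        ≤⟨ +-monoʳ-≤ (classSize 1 + classSize 2 + classSize 3) large-classes ⟩
      classSize 1 + classSize 2 + classSize 3 + (j ∸ 3)         ∎
      where
      open ≤-Reasoning
      c : ℕ → V → ℕ
      c i v = ⟦ class? i v ⟧
      large : V → ℕ
      large v = ∑[ i ∈ upTo (j ∸ 3) ] ⟦ class? (4 + i) v ⟧
      coloured : ∀ v → 1 ≤ c 1 v + c 2 v + c 3 v + large v
      coloured v with Γ v in eq | range v
      ... | 0 | () , _
      ... | 1 | _ = m≤m+n 1 _
      ... | 2 | _ = m≤m+n 1 _
      ... | 3 | _ = m≤m+n 1 _
      -- Colour `4 + i` is the entry `i` of `upTo (j ∸ 3)`, in range because `4 + i ≤ j`.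
      ... | suc (suc (suc (suc i))) | _ , 4+i≤j =
        ≤-trans (≤-reflexive (sym (⟦⟧-yes (4 + i ≟ℕ 4 + i) refl)))
          (∈⇒≤∑ (upTo (j ∸ 3)) (λ i′ → ⟦ 4 + i ≟ℕ 4 + i′ ⟧) (∈-upTo⁺ (∸-monoˡ-≤ 3 4+i≤j)))

    rest+3≤colours : m * (q ∸ 1) + 3 ≤ j
    rest+3≤colours with 3 ≤? j
    ... | yes 3≤j = subst (rest + 3 ≤_) (m∸n+n≡m 3≤j) (+-monoˡ-≤ 3 (+-cancelˡ-≤ (n + m + m) _ _ (begin
        n + m + m + rest                                     ≡⟨ shuffle n m rest ⟩
        n + (rest + (m + m))                                 ≡⟨ cong (n +_) (sym n≡rest+m+m) ⟩
        n + n                                                ≤⟨ vertex-count ⟩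
        classSize 1 + classSize 2 + classSize 3 + (j ∸ 3)
          ≤⟨ +-monoˡ-≤ (j ∸ 3) (+-mono-≤ class₁₂≤n+m class₃≤m) ⟩
        n + m + m + (j ∸ 3)                                  ∎)))
      where
      open ≤-Reasoning
      rest = m * (q ∸ 1)
      shuffle : ∀ n m r → n + m + m + r ≡ n + (r + (m + m))
      shuffle = solve-∀
    -- With fewer than three colours `j ∸ 3` is truncated to 0. Class 3 is then empty, so
    -- `n + n ≤ n + m`, against `m < m + m ≤ n`.
    ... | no 3≰j = contradiction (+-cancelˡ-≤ n n m (begin
        n + n                                                ≤⟨ vertex-count ⟩
        classSize 1 + classSize 2 + classSize 3 + (j ∸ 3)
          ≡⟨ cong₂ (λ x y → classSize 1 + classSize 2 + x + y) (class-empty 3 (≰⇒> 3≰j)) (m≤n⇒m∸n≡0 (<⇒≤ (≰⇒> 3≰j))) ⟩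
        classSize 1 + classSize 2 + 0 + 0                    ≡⟨ trans (+-identityʳ _) (+-identityʳ _) ⟩
        classSize 1 + classSize 2                            ≤⟨ class₁₂≤n+m ⟩
        n + m                                                ∎))
      (<⇒≱ (subst (m <_) (sym n≡rest+m+m) (≤-trans (m<m+n m m>0) (m≤n+m (m + m) (m * (q ∸ 1))))))
      where open ≤-Reasoning

  -- The equality case.

  module _ {Γ} (colouring : IsPackingColoring G (m * (q ∸ 1) + 3) Γ) where

    private
      a = classSize colouring 1
      b = classSize colouring 2
      c = classSize colouring 3
      rest = m * (q ∸ 1)
      open ≤-Reasoning

      n+m+m≤a+b+c : n + m + m ≤ a + b + c
      n+m+m≤a+b+c = +-cancelʳ-≤ rest _ _ (begin
        n + m + m + rest             ≡⟨ shuffle n m rest ⟩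
        n + (rest + (m + m))         ≡⟨ cong (n +_) (sym n≡rest+m+m) ⟩
        n + n                        ≤⟨ vertex-count colouring ⟩
        a + b + c + (rest + 3 ∸ 3)   ≡⟨ cong (a + b + c +_) (m+n∸n≡m rest 3) ⟩
        a + b + c + rest             ∎)
        where
        shuffle : ∀ n m r → n + m + m + r ≡ n + (r + (m + m))
        shuffle = solve-∀

    class₁₂≡n+m : a + b ≡ n + m
    class₁₂≡n+m = ≤-antisym (class₁₂≤n+m colouring) (+-cancelʳ-≤ m _ _
      (≤-trans n+m+m≤a+b+c (+-monoʳ-≤ (a + b) (class₃≤m colouring))))

    class₃≡m : c ≡ m
    class₃≡m = ≤-antisym (class₃≤m colouring) (+-cancelˡ-≤ (n + m) _ _
      (≤-trans n+m+m≤a+b+c (+-monoˡ-≤ c (class₁₂≤n+m colouring))))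

    -- With `a + b` equal to `n + m`, the edge count reads `k * n + k * m ≤ k * n + a`, and `k * m`
    -- is `n`.
    class₁≡n : a ≡ n
    class₁≡n = ≤-antisym (class₁≤n colouring) (+-cancelˡ-≤ (k * n) _ _ (begin
      k * n + k * m     ≡⟨ sym (*-distribˡ-+ k n m) ⟩
      k * (n + m)       ≡⟨ cong (k *_) (sym class₁₂≡n+m) ⟩
      k * (a + b)       ≤⟨ class₁₂-edges colouring ⟩
      k * n + a         ∎))

    class₂≡m : b ≡ m
    class₂≡m = +-cancelˡ-≡ n _ _ (trans (cong (_+ b) (sym class₁≡n)) class₁₂≡n+m)

    -- Equality forces every edge to have exactly one end of colour 1, so
    -- by connectivity colour 1 is one whole side.
    class₁-is-side : ∃ λ t → ∀ v → ⟦ class? colouring 1 v ⟧ + ⟦ side v ≟ᵇ t ⟧ ≡ 1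
    class₁-is-side = t , λ v →
      let _ , (walk , _) , _ = diameter≤4 someVertex v in along walk base
      where
      Complementary : Bool → V → Set
      Complementary t v = ⟦ class? colouring 1 v ⟧ + ⟦ side v ≟ᵇ t ⟧ ≡ 1
      startSide : ∃ λ t → Complementary t someVertex
      -- The side `t` is the one free of colour 1, where classes 2 and 3 will lie. It is read off
      -- from the colour of a single vertex.
      startSide with class? colouring 1 someVertex
      ... | yes _ = not (side someVertex) , cong suc (⟦⟧-no (side someVertex ≟ᵇ _) (not-¬ refl))
      ... | no _ = side someVertex , ⟦⟧-yes (side someVertex ≟ᵇ _) refl
      t = proj₁ startSide
      base = proj₂ startSide
      sides : ∀ {v w} → Adj v w → ⟦ side v ≟ᵇ t ⟧ + ⟦ side w ≟ᵇ t ⟧ ≡ 1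
      sides {v} vw rewrite bipartite vw with side v | t
      ... | true | true = refl
      ... | true | false = refl
      ... | false | true = refl
      ... | false | false = refl
      step : ∀ {v w} → Adj v w → Complementary t v → Complementary t w
      step {v} {w} vw compl-v = trans (cong₂ _+_ c-w s-w) (trans (+-comm s (c₁ v)) compl-v)
        where
        c₁ : V → ℕ
        c₁ v = ⟦ class? colouring 1 v ⟧
        s = ⟦ side v ≟ᵇ t ⟧
        c-w : c₁ w ≡ s
        c-w = +-cancelˡ-≡ (c₁ v) _ _ (trans
          (independent-tight (class-independent colouring 1 ≤-refl) class₁≡n vw) (sym compl-v))
        s-w : ⟦ side w ≟ᵇ t ⟧ ≡ c₁ v
        s-w = +-cancelˡ-≡ s _ _ (trans (sides vw) (sym (trans (+-comm s (c₁ v)) compl-v)))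
      along : ∀ {u v i} → Walk G u v i → Complementary t u → Complementary t v
      along [] compl = compl
      along (uv ∷ walk) compl = along walk (step uv compl)

    classes-ovoidal : ∃ λ t → IsOvoidal t (λ v → Γ v ≡ 2) × IsOvoidal t (λ v → Γ v ≡ 3)
    classes-ovoidal with t , compl ← class₁-is-side =
      t , spaced⇒ovoidal (class? colouring 2) (class-spaced colouring 2) (on-side 2 λ ()) class₂≡m
        , spaced⇒ovoidal (class? colouring 3) (λ Γu Γv u≢v d dist → ≤-trans (n≤1+n 3) (class-spaced colouring 3 Γu Γv u≢v d dist)) (on-side 3 λ ()) class₃≡m
      where
      on-side : ∀ i → i ≢ 1 → ∀ {v} → Γ v ≡ i → side v ≡ t
      on-side i i≢1 {v} Γv≡i = ⟦⟧-true (side v ≟ᵇ t) (≤-reflexive (sym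
        (trans (cong (_+ ⟦ side v ≟ᵇ t ⟧) (sym (⟦⟧-no (class? colouring 1 v) λ Γv≡1 → i≢1 (trans (sym Γv≡i) Γv≡1)))) (compl v))))

  -- The colouring given by two disjoint ovoidal sets.

  module _ {t : Bool} {O₁ O₂ : Pred V 0ℓ} (ovoidal₁ : IsOvoidal t O₁) (ovoidal₂ : IsOvoidal t O₂)
    (disjoint : ∀ {v} → O₁ v → ¬ O₂ v) where

    private
      module O₁ = IsOvoidal ovoidal₁
      module O₂ = IsOvoidal ovoidal₂

      cardinality⇒decidable : ∀ {P : Pred V 0ℓ} {c} → HasCardinality P c → Decidable P
      cardinality⇒decidable (xs , _ , xs⇔ , _) v =
        map′ (Equivalence.to (xs⇔ v)) (Equivalence.from (xs⇔ v)) (v ∈? xs)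

      O₁? : Decidable O₁
      O₁? = cardinality⇒decidable O₁.size

      O₂? : Decidable O₂
      O₂? = cardinality⇒decidable O₂.size

      Rest : Pred V 0ℓ
      Rest v = side v ≡ t × ¬ O₁ v × ¬ O₂ v

      rest? : Decidable Rest
      rest? v = (side v ≟ᵇ t) ×-dec ¬? (O₁? v) ×-dec ¬? (O₂? v)

      rest : List V
      rest = filter rest? vertices

      length-rest : length rest ≡ m * (q ∸ 1)
      length-rest = +-cancelʳ-≡ (m + m) _ _ (begin
        length rest + (m + m)
          ≡⟨ cong₂ _+_ (sym (∑-⟦⟧ rest? vertices)) (sym (cong₂ _+_ (cardinality⇒∑ O₁? O₁.size) (cardinality⇒∑ O₂? O₂.size))) ⟩
        ∑ᵥ r + (∑ᵥ o₁ + ∑ᵥ o₂)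
          ≡⟨ cong (∑ᵥ r +_) (sym (∑-distrib-+ vertices o₁ o₂)) ⟩
        ∑ᵥ r + (∑[ v ] (o₁ v + o₂ v))
          ≡⟨ sym (∑-distrib-+ vertices r _) ⟩
        ∑[ v ] (r v + (o₁ v + o₂ v))
          ≡⟨ ∑-cong vertices split ⟩
        ∑[ v ] ⟦ side v ≟ᵇ t ⟧                                                    ≡⟨ ∑-side t ⟩
        n                                                                         ≡⟨ n≡rest+m+m ⟩
        m * (q ∸ 1) + (m + m)                                                     ∎)
        where
        open ≡-Reasoning
        r o₁ o₂ : V → ℕ
        r v = ⟦ rest? v ⟧
        o₁ v = ⟦ O₁? v ⟧
        o₂ v = ⟦ O₂? v ⟧
        split : ∀ v → r v + (o₁ v + o₂ v) ≡ ⟦ side v ≟ᵇ t ⟧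
        split v with side v ≟ᵇ t | O₁? v | O₂? v
        ... | no s≢t | yes O₁v | _ = contradiction (O₁.on-side O₁v) s≢t
        ... | no s≢t | no _ | yes O₂v = contradiction (O₂.on-side O₂v) s≢t
        ... | no _ | no _ | no _ = refl
        ... | yes _ | yes O₁v | yes O₂v = contradiction O₂v (disjoint O₁v)
        ... | yes _ | yes _ | no _ = refl
        ... | yes _ | no _ | yes _ = refl
        ... | yes _ | no _ | no _ = refl

      -- The reason why `v` receives colour `i`. Keeping the value of `i` as an equation lets `far`
      -- dismiss pairs of different constructors by a numerical clash. The remaining vertices get
      -- the pairwise distinct colours from 4 on, by position in `rest`.
      data Colour (v : V) (i : ℕ) : Set where
        opposite-side : side v ≡ not t → i ≡ 1 → Colour v i
        first         : O₁ v → i ≡ 2 → Colour v i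
        second        : O₂ v → i ≡ 3 → Colour v i
        own           : (v∈ : v ∈ rest) → i ≡ 4 + toℕ (index v∈) → Colour v i

      colour : ∀ v → ∃ (Colour v)
      colour v with side v ≟ᵇ t | O₁? v | O₂? v
      ... | no s≢t | _ | _ = _ , opposite-side (¬-not s≢t) refl
      ... | yes _ | yes O₁v | _ = _ , first O₁v refl
      ... | yes _ | no _ | yes O₂v = _ , second O₂v refl
      ... | yes s≡t | no ¬O₁v | no ¬O₂v =
        _ , own (∈-filter⁺ rest? (elements-complete v) (s≡t , ¬O₁v , ¬O₂v)) refl

      in-range : ∀ {v i} → Colour v i → 1 ≤ i × i ≤ m * (q ∸ 1) + 3
      in-range (opposite-side _ refl) = s≤s z≤n , ≤-trans (s≤s z≤n) (m≤n+m 3 (m * (q ∸ 1)))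
      in-range (first _ refl) = s≤s z≤n , ≤-trans (s≤s (s≤s z≤n)) (m≤n+m 3 (m * (q ∸ 1)))
      in-range (second _ refl) = s≤s z≤n , m≤n+m 3 (m * (q ∸ 1))
      in-range (own v∈ refl) = s≤s z≤n , subst (4 + toℕ (index v∈) ≤_) (+-comm 3 _)
        (+-monoʳ-≤ 3 (subst (toℕ (index v∈) <_) length-rest (toℕ<n (index v∈))))

      opposite⇒far : ∀ {u v i} → i ≤ 4 → Distance G u v 4 → DistanceAtLeast G u v i
      opposite⇒far i≤4 (_ , least) d (walk , _) = ≤-trans i≤4 (least d walk)

      far : ∀ {u v i} → Colour u i → Colour v i → u ≢ v → DistanceAtLeast G u v (i + 1)
      far (opposite-side s-u refl) (opposite-side s-v _) =
        same-side-spaced {P = λ v → side v ≡ not t} (λ s → s) s-u s-v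
      far (first O₁u refl) (first O₁v _) u≢v = opposite⇒far (n≤1+n 3) (O₁.opposite O₁u O₁v u≢v)
      far (second O₂u refl) (second O₂v _) u≢v = opposite⇒far ≤-refl (O₂.opposite O₂u O₂v u≢v)
      -- Equal colours mean equal positions in `rest`, hence equal vertices.
      far (own u∈ refl) (own v∈ eq) u≢v = contradiction
        (trans (lookup-index u∈) (trans
          (cong (lookup rest) (toℕ-injective (+-cancelˡ-≡ 4 _ _ eq)))
          (sym (lookup-index v∈)))) u≢v
      far (opposite-side _ refl) (first _ ())
      far (opposite-side _ refl) (second _ ())
      far (opposite-side _ refl) (own _ ())
      far (first _ refl) (opposite-side _ ())
      far (first _ refl) (second _ ())
      far (first _ refl) (own _ ())
      far (second _ refl) (opposite-side _ ())
      far (second _ refl) (first _ ())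
      far (second _ refl) (own _ ())
      far (own _ refl) (opposite-side _ ())
      far (own _ refl) (first _ ())
      far (own _ refl) (second _ ())

    ovoidal⇒colouring : HasPackingColoring G (m * (q ∸ 1) + 3)
    ovoidal⇒colouring = (λ v → proj₁ (colour v)) , record
      { range = λ v → in-range (proj₂ (colour v))
      ; packing = λ { _ u v u≢v refl Γv≡ → far (proj₂ (colour u)) (subst (Colour v) Γv≡ (proj₂ (colour v))) u≢v }
      }

-- Translation between ovoidal sets and ovoids or spreads.

cardinality-map : {P : Pred A 0ℓ} {P′ : Pred B 0ℓ} (f : A → B) → (∀ {x y} → f x ≡ f y → x ≡ y) →
  (∀ {x} → P x → P′ (f x)) → (∀ {y} → P′ y → ∃ λ x → P x × y ≡ f x) →
  ∀ {c} → HasCardinality P c → HasCardinality P′ c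
cardinality-map {P′ = P′} f injective to from (xs , xs! , xs⇔ , refl) =
  map f xs , map⁺ injective xs! ,
  (λ y → mk⇔
    (λ y∈ → let x , x∈ , y≡ = ∈-map⁻ f y∈ in subst P′ (sym y≡) (to (Equivalence.to (xs⇔ x) x∈)))
    (λ P′y → let x , Px , y≡ = from P′y in subst (_∈ map f xs) (sym y≡) (∈-map⁺ f (Equivalence.from (xs⇔ x) Px)))) ,
  length-map f xs

-- Instead of pulling a list back along `f`, `P` is counted by filtering its own type. The image
-- list then enumerates `P′`, and uniqueness of cardinality identifies the number.
cardinality-comap : {P : Pred A 0ℓ} {P′ : Pred B 0ℓ} → Finite A → Decidable P →
  (f : A → B) → (∀ {x y} → f x ≡ f y → x ≡ y) →
  (∀ {x} → P x → P′ (f x)) → (∀ {y} → P′ y → ∃ λ x → P x × y ≡ f x) →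
  ∀ {c} → HasCardinality P′ c → HasCardinality P c
cardinality-comap {P = P} finite P? f injective to from h = subst (HasCardinality P)
  (cardinality-unique (cardinality-map f injective to from card) h) card
  where card = FiniteSet.filter-cardinality finite P?

module Quadrangle (q : ℕ) (Q : GeneralizedQuadrangle q) where

  open GeneralizedQuadrangle Q
  open IncidenceStructure structure
  open IsGeneralizedQuadrangle isGeneralizedQuadrangle

  private
    G = incidenceGraph structure
  open Graph G using (V; Adj)

  isPoint : V → Bool
  isPoint (inj₁ _) = true
  isPoint (inj₂ _) = false

  bipartite : ∀ {u v} → Adj u v → isPoint v ≡ not (isPoint u)
  bipartite (point-line _) = refl
  bipartite (line-point _) = refl

  degree : ∀ v → HasCardinality (Adj v) (suc q)
  degree (inj₁ p) = cardinality-map inj₂ inj₂-injective point-line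
    (λ { (point-line pIl) → _ , pIl , refl }) (subst (HasCardinality _) (+-comm q 1) (linesOnPoint p))
  degree (inj₂ l) = cardinality-map inj₁ inj₁-injective line-point
    (λ { (line-point pIl) → _ , pIl , refl }) (subst (HasCardinality _) (+-comm q 1) (pointsOnLine l))

  no-4-cycle : ∀ {a b c d} → Adj a b → Adj b c → Adj c d → Adj d a → a ≢ c → b ≡ d
  no-4-cycle (point-line ab) (line-point cb) (point-line cd) (line-point ad) a≢c =
    cong inj₂ (atMostOneJoin _ _ (a≢c ∘ cong inj₁) _ _ ab cb ad cd)
  no-4-cycle (line-point ba) (point-line bc) (line-point dc) (point-line da) a≢c =
    cong inj₁ (atMostOneMeet _ _ (a≢c ∘ cong inj₂) _ _ ba bc da dc)

  no-6-cycle : ¬ HasCycleOfLength G 6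
  no-6-cycle cycle = <⇒≱ (n≤1+n 7) (proj₂ girth 6 cycle)

  open Incidence G isPoint q 1≤q (inj₁ somePoint) bipartite degree (proj₁ diameter) no-4-cycle no-6-cycle

  ovoid⇒ovoidal : ∀ {O} → IsOvoid structure q O → IsOvoidal true [ O , (λ _ → ⊥) ]
  ovoid⇒ovoidal ovoid = record
    { size = cardinality-map inj₁ inj₁-injective id (λ { {inj₁ p} Op → p , Op , refl ; {inj₂ _} () }) size
    ; on-side = λ { {inj₁ _} _ → refl ; {inj₂ _} () }
    ; opposite = λ { {inj₁ p} {inj₁ p′} Op Op′ p≢p′ → opposite p p′ Op Op′ (p≢p′ ∘ cong inj₁)
                 ; {inj₁ _} {inj₂ _} _ () ; {inj₂ _} () }
    ; covering = λ x → let p , Op , close = covering x in inj₁ p , Op , close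
    }
    where open IsOvoid ovoid

  spread⇒ovoidal : ∀ {S} → IsSpread structure q S → IsOvoidal false [ (λ _ → ⊥) , S ]
  spread⇒ovoidal spread = record
    { size = cardinality-map inj₂ inj₂-injective id (λ { {inj₁ _} () ; {inj₂ l} Sl → l , Sl , refl }) size
    ; on-side = λ { {inj₁ _} () ; {inj₂ _} _ → refl }
    ; opposite = λ { {inj₂ l} {inj₂ l′} Sl Sl′ l≢l′ → opposite l l′ Sl Sl′ (l≢l′ ∘ cong inj₂)
                 ; {inj₂ _} {inj₁ _} _ () ; {inj₁ _} () }
    ; covering = λ x → let l , Sl , close = covering x in inj₂ l , Sl , close
    }
    where open IsSpread spread

  ovoidal⇒ovoid : ∀ {P} → Decidable P → IsOvoidal true P → IsOvoid structure q (P ∘ inj₁)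
  ovoidal⇒ovoid {P} P? ovoidal = record
    { size = cardinality-comap finiteP (P? ∘ inj₁) inj₁ inj₁-injective id isInj₁ size
    ; opposite = λ p p′ Pp Pp′ p≢p′ → opposite Pp Pp′ (p≢p′ ∘ inj₁-injective)
    ; covering = λ x → point (covering x)
    }
    where
    open IsOvoidal ovoidal
    isInj₁ : ∀ {v} → P v → ∃ λ p → P (inj₁ p) × v ≡ inj₁ p
    isInj₁ {inj₁ p} Pp = p , Pp , refl
    isInj₁ {inj₂ l} Pl = contradiction (on-side Pl) λ ()
    point : ∀ {x} → (∃ λ w → P w × DistanceAtMost G x w 2) → ∃ λ p → P (inj₁ p) × DistanceAtMost G x (inj₁ p) 2
    point (w , Pw , close) with p , Pp , refl ← isInj₁ Pw = p , Pp , close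

  ovoidal⇒spread : ∀ {P} → Decidable P → IsOvoidal false P → IsSpread structure q (P ∘ inj₂)
  ovoidal⇒spread {P} P? ovoidal = record
    { size = cardinality-comap finiteL (P? ∘ inj₂) inj₂ inj₂-injective id isInj₂ size
    ; opposite = λ l l′ Pl Pl′ l≢l′ → opposite Pl Pl′ (l≢l′ ∘ inj₂-injective)
    ; covering = λ x → line (covering x)
    }
    where
    open IsOvoidal ovoidal
    isInj₂ : ∀ {v} → P v → ∃ λ l → P (inj₂ l) × v ≡ inj₂ l
    isInj₂ {inj₁ p} Pp = contradiction (on-side Pp) λ ()
    isInj₂ {inj₂ l} Pl = l , Pl , refl
    line : ∀ {x} → (∃ λ w → P w × DistanceAtMost G x w 2) → ∃ λ l → P (inj₂ l) × DistanceAtMost G x (inj₂ l) 2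
    line (w , Pw , close) with l , Pl , refl ← isInj₂ Pw = l , Pl , close

  -- Minimality is `rest+3≤colours`, which holds for every packing colouring, so exhibiting one
  -- colouring suffices.
  chromaticNumber : HasPackingColoring G (m * (q ∸ 1) + 3) →
    PackingChromaticNumberIs G (m * (q ∸ 1) + 3)
  chromaticNumber colouring = colouring , λ _ (_ , colouring′) → rest+3≤colours colouring′

  ovoids-or-spreads⇒chromaticNumber : TwoDisjointOvoids structure q ⊎ TwoDisjointSpreads structure q →
    PackingChromaticNumberIs G (m * (q ∸ 1) + 3)
  ovoids-or-spreads⇒chromaticNumber (inj₁ (_ , _ , ovoid₁ , ovoid₂ , disjoint)) =
    chromaticNumber (ovoidal⇒colouring (ovoid⇒ovoidal ovoid₁) (ovoid⇒ovoidal ovoid₂)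
      λ { {inj₁ _} Op O′p → disjoint (Op , O′p) ; {inj₂ _} () })
  ovoids-or-spreads⇒chromaticNumber (inj₂ (_ , _ , spread₁ , spread₂ , disjoint)) =
    chromaticNumber (ovoidal⇒colouring (spread⇒ovoidal spread₁) (spread⇒ovoidal spread₂)
      λ { {inj₁ _} () ; {inj₂ _} Sl S′l → disjoint (Sl , S′l) })

  ovoidals⇒ovoids-or-spreads : ∀ {P P′} → Decidable P → Decidable P′ → (∀ {v} → P v → ¬ P′ v) →
    (∃ λ t → IsOvoidal t P × IsOvoidal t P′) →
    TwoDisjointOvoids structure q ⊎ TwoDisjointSpreads structure q
  ovoidals⇒ovoids-or-spreads P? P′? disjoint (true , ovoidal , ovoidal′) = inj₁ (_ , _ ,
    ovoidal⇒ovoid P? ovoidal , ovoidal⇒ovoid P′? ovoidal′ , λ (Pp , P′p) → disjoint Pp P′p)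
  ovoidals⇒ovoids-or-spreads P? P′? disjoint (false , ovoidal , ovoidal′) = inj₂ (_ , _ ,
    ovoidal⇒spread P? ovoidal , ovoidal⇒spread P′? ovoidal′ , λ (Pl , P′l) → disjoint Pl P′l)

  chromaticNumber⇒ovoids-or-spreads : PackingChromaticNumberIs G (m * (q ∸ 1) + 3) →
    TwoDisjointOvoids structure q ⊎ TwoDisjointSpreads structure q
  chromaticNumber⇒ovoids-or-spreads ((_ , colouring) , _) =
    ovoidals⇒ovoids-or-spreads (class? colouring 2) (class? colouring 3)
      (λ Γ≡2 Γ≡3 → contradiction (trans (sym Γ≡2) Γ≡3) λ ()) (classes-ovoidal colouring)

corollary3p1 : (q : ℕ) (Q : GeneralizedQuadrangle q) →
    let open GeneralizedQuadrangle Q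
        G = incidenceGraph structure
    in (TwoDisjointOvoids structure q ⊎ TwoDisjointSpreads structure q)
         ⇔ PackingChromaticNumberIs G ((q ^ 2 + 1) * (q ∸ 1) + 3)
corollary3p1 q Q = mk⇔ ovoids-or-spreads⇒chromaticNumber chromaticNumber⇒ovoids-or-spreads
  where open Quadrangle q Q
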